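{- For nonnegative integers $n$ and $k$, $$\left|\mathcal{T}_{n,k}\right| = \sum_{m=k}^n \binom{n+1}{m+1} S(m+1,k+1)\, k!\, (n-k)^{n-m-1} (m-k),$$ where $S(a,b)$ denotes the Stirling number of the second kind.
   Context: For a nonnegative integer $n$, let $\mathcal{T}_n$ be the set of rooted labeled trees on the vertex set $[0,n]=\{0,1,\dots,n\}$. For $T\in\mathcal{T}_n$, the maximal decreasing subtree $\mathrm{MD}(T)$ is the subtree of $T$ induced by the root together with all vertices $v$ such that the labels strictly decrease along the path from the root to $v$ (i.e. the maximal subtree containing the root in which every edge goes from a larger label (parent) to a smaller label (child)). Let $\mathcal{T}_{n,k}$ be the set of $T\in\mathcal{T}_n$ such that $\mathrm{MD}(T)$ has exactly $k+1$ vertices. In the sum, the factor $(n-k)^{n-m-1}(m-k)$ (the number of rooted forests on $n-k$ labeled vertices with a prescribed set of $m-k$ roots) is interpreted as $1$ when $m=n$. -}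

module Defs where

open import Data.Nat using (ℕ; zero; suc; _+_; _*_; _∸_; _^_; _<ᵇ_; _≡ᵇ_; _!)
open import Data.Nat.Combinatorics using (_C_)
open import Data.Bool using (Bool; true; false; if_then_else_; _∧_)
open import Data.Maybe using (Maybe; just; nothing)
open import Data.Fin using (Fin; toℕ)
open import Data.Vec using (Vec; lookup)
open import Data.Nat.ListAction using (sum)
open import Data.List using (List; map; upTo; allFin; filter; length)
open import Data.List.Relation.Unary.All using ()
open import Data.Product using (Σ; _×_)
open import Relation.Binary.PropositionalEquality using (_≡_)
open import Relation.Nullary.Decidable using ()
import Data.Bool.Properties

-- A rooted labeled tree on the vertex set [0,n] = Fin (suc n) is encoded by
-- its parent map: entry v is 'just u' if u is the parent of v, and 'nothing'
-- if v is the root.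
ParentMap : ℕ → Set
ParentMap n = Vec (Maybe (Fin (suc n))) (suc n)

reachesRoot : ∀ {n} → ParentMap n → ℕ → Fin (suc n) → Bool
reachesRoot p fuel v with lookup p v
... | nothing = true
reachesRoot p zero v | just u = false
reachesRoot p (suc fuel) v | just u = reachesRoot p fuel u

countV : ∀ {n} → (Fin (suc n) → Bool) → ℕ
countV {n} P = length (filter (λ v → Data.Bool.Properties.T? (P v)) (allFin (suc n)))

isRootB : ∀ {n} → ParentMap n → Fin (suc n) → Bool
isRootB p v with lookup p v
... | nothing = true
... | just _ = false

isRootedTree : ∀ {n} → ParentMap n → Bool
isRootedTree {n} p =
  (countV (isRootB p) ≡ᵇ 1) ∧ (countV (reachesRoot p (suc n)) ≡ᵇ suc n)

-- v belongs to the maximal decreasing subtree: labels strictly decrease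
-- along the path from the root down to v, i.e. every parent on the path
-- to the root has larger label than its child.
inMD : ∀ {n} → ParentMap n → ℕ → Fin (suc n) → Bool
inMD p fuel v with lookup p v
... | nothing = true
inMD p zero v | just u = false
inMD p (suc fuel) v | just u = (toℕ v <ᵇ toℕ u) ∧ inMD p fuel u

mdSize : ∀ {n} → ParentMap n → ℕ
mdSize {n} p = countV (inMD p (suc n))

-- 𝒯_{n,k} as a subtype of parent maps (Bool equalities are propositions)
T[_,_] : ℕ → ℕ → Set
T[ n , k ] = Σ (ParentMap n) (λ p → (isRootedTree p ≡ true) × (mdSize p ≡ suc k))

S₂ : ℕ → ℕ → ℕ
S₂ zero zero = 1
S₂ zero (suc b) = 0
S₂ (suc a) zero = 0
S₂ (suc a) (suc b) = suc b * S₂ a (suc b) + S₂ a b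

-- the factor (n-k)^(n-m-1) (m-k), interpreted as 1 when m = n
forestFactor : ℕ → ℕ → ℕ → ℕ
forestFactor n k m = if m ≡ᵇ n then 1 else (n ∸ k) ^ (n ∸ m ∸ 1) * (m ∸ k)

-- Σ_{m=k}^{n} f m  (empty, i.e. 0, when k > n)
sumFromTo : ℕ → ℕ → (ℕ → ℕ) → ℕ
sumFromTo k n f = sum (map (λ i → f (k + i)) (upTo (suc n ∸ k)))

rhs : ℕ → ℕ → ℕ
rhs n k = sumFromTo k n (λ m →
  (suc n C suc m) * S₂ (suc m) (suc k) * (k !) * forestFactor n k m)

{-# OPTIONS --safe #-}

-- Put a vertex of T on level 0 if it lies in MD(T), and otherwise one level below
-- its parent. Given the levels, the condition on a parent map is local: a vertex of
-- MD(T) that is not the largest one has a larger parent in MD(T), a vertex of level 1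
-- has a smaller parent in MD(T), and a vertex of level i + 1 ≥ 2 has any parent of
-- level i. So |T_{n,k}| is a sum over level labellings of products of numbers of
-- available parents. Vertices of level 0 contribute k!; distributing the levels 0 and 1
-- over m + 1 vertices with k + 1 of level 0, weighted by the choices at level 1, is
-- counted by S(m+1,k+1); and the deeper levels, summed layer by layer with the binomial
-- theorem, give the forests with prescribed roots.
module Submission where

open import Defs
open import Axiom.UniquenessOfIdentityProofs using (module Decidable⇒UIP)
open import Data.Nat
open import Data.Nat.Properties
open import Data.Nat.Combinatorics using (_C_; nCk+nC[k+1]≡[n+1]C[k+1]; k>n⇒nCk≡0)
open import Data.Nat.ListAction using (sum)
open import Data.Nat.Tactic.RingSolver using (solve-∀)
open import Data.Bool using (Bool; true; false; not; _∧_; if_then_else_)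
open import Data.Bool.Properties as Bool using (T-≡; T?; ¬-not; ∧-conicalˡ; ∧-conicalʳ; ∧-zeroʳ)
open import Data.Empty using (⊥)
open import Data.Unit using (⊤; tt)
open import Data.Maybe using (Maybe; just; nothing)
open import Data.Fin using (Fin; zero; suc; toℕ)
import Data.Fin.Properties as Fin
open import Data.List using (List; []; _∷_; mapMaybe; length; filter; tabulate; applyUpTo)
open import Data.List.Properties using (map-upTo)
open import Data.Product using (Σ; ∃; _×_; _,_; proj₂)
open import Data.Product.Function.Dependent.Propositional using (Σ-↔)
open import Data.Sum using (_⊎_; inj₁; inj₂; isInj₁; isInj₂)
open import Data.Sum.Function.Propositional using (_⊎-↔_)
open import Data.Vec as Vec using (Vec; []; _∷_; lookup; toList)
import Data.Vec.Properties as Vec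
open import Function using (_∘_; id)
open import Function.Bundles using (_↔_; Inverse; mk↔ₛ′; Equivalence)
open import Function.Construct.Composition using (_↔-∘_)
open import Function.Construct.Identity using (↔-id)
open import Function.Construct.Symmetry using (↔-sym)
open import Relation.Binary.PropositionalEquality
open import Relation.Nullary using (¬_; contradiction)

open ≡-Reasoning

private variable
  A B : Set

+-interchange : ∀ a b c d → (a + b) + (c + d) ≡ (a + c) + (b + d)
+-interchange = solve-∀

+-left-comm : ∀ a b c → a + (b + c) ≡ b + (a + c)
+-left-comm = solve-∀

*-left-comm : ∀ a b c → a * (b * c) ≡ b * (a * c)
*-left-comm = solve-∀

-- Finite sums and cardinalities

-- A code of a finite type by its construction. Sums are computed by recursion on the code, so each
-- law of summation is proved once, by induction over these constructors.
data Summable : Set → Set₁ where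
  none   : Summable ⊥
  single : Summable ⊤
  _⊕_    : Summable A → Summable B → Summable (A ⊎ B)
  _⊗_    : Summable A → Summable B → Summable (A × B)
  via    : A ↔ B → Summable A → Summable B

∑ : Summable A → (A → ℕ) → ℕ
∑ none      f = 0
∑ single    f = f tt
∑ (s ⊕ t)   f = ∑ s (f ∘ inj₁) + ∑ t (f ∘ inj₂)
∑ (s ⊗ t)   f = ∑ s λ a → ∑ t λ b → f (a , b)
∑ (via e s) f = ∑ s (f ∘ Inverse.to e)

∑-cong : (s : Summable A) {f g : A → ℕ} → (∀ a → f a ≡ g a) → ∑ s f ≡ ∑ s g
∑-cong none      h = refl
∑-cong single    h = h tt
∑-cong (s ⊕ t)   h = cong₂ _+_ (∑-cong s (h ∘ inj₁)) (∑-cong t (h ∘ inj₂))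
∑-cong (s ⊗ t)   h = ∑-cong s λ a → ∑-cong t λ b → h (a , b)
∑-cong (via e s) h = ∑-cong s (h ∘ Inverse.to e)

record Additive (φ : (B → ℕ) → ℕ) : Set where
  field
    φ-0 : φ (λ _ → 0) ≡ 0
    φ-+ : ∀ f g → φ (λ b → f b + g b) ≡ φ f + φ g

open Additive

-- A sum is assembled from `0` and `+` alone, so it commutes with everything that preserves these.
-- Scaling, adding and exchanging sums are special cases, for suitable `B`.
∑-exchange : (s : Summable A) {φ : (B → ℕ) → ℕ} → Additive φ → (f : A → B → ℕ) →
             ∑ s (λ a → φ (f a)) ≡ φ (λ b → ∑ s (λ a → f a b))
∑-exchange none      add f = sym (φ-0 add)
∑-exchange single    add f = refl
∑-exchange (s ⊕ t)   add f =
  trans (cong₂ _+_ (∑-exchange s add (f ∘ inj₁)) (∑-exchange t add (f ∘ inj₂)))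
        (sym (φ-+ add _ _))
∑-exchange (s ⊗ t)   add f =
  trans (∑-cong s λ a → ∑-exchange t add (λ b → f (a , b)))
        (∑-exchange s add (λ a c → ∑ t (λ b → f (a , b) c)))
∑-exchange (via e s) add f = ∑-exchange s add (f ∘ Inverse.to e)

∑-*ˡ : (s : Summable A) (c : ℕ) (f : A → ℕ) → ∑ s (λ a → c * f a) ≡ c * ∑ s f
∑-*ˡ s c f = ∑-exchange s {φ = λ g → c * g tt}
  (record { φ-0 = *-zeroʳ c ; φ-+ = λ f g → *-distribˡ-+ c (f tt) (g tt) }) (λ a _ → f a)

∑-*ʳ : (s : Summable A) (c : ℕ) (f : A → ℕ) → ∑ s (λ a → f a * c) ≡ ∑ s f * c
∑-*ʳ s c f = trans (∑-cong s λ a → *-comm (f a) c) (trans (∑-*ˡ s c f) (*-comm c _))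

∑-additive : (s : Summable A) → Additive (∑ s)
∑-additive s = record
  { φ-0 = ∑-exchange s {φ = λ _ → 0} (record { φ-0 = refl ; φ-+ = λ _ _ → refl }) (λ _ (_ : ⊤) → 0)
  -- A function on `Bool` is a pair of numbers, and adding the pair is itself an additive
  -- functional.
  ; φ-+ = λ f g → ∑-exchange s {φ = λ h → h true + h false}
      (record { φ-0 = refl ; φ-+ = λ h k → +-interchange (h true) (k true) (h false) (k false) })
      (λ { a true → f a ; a false → g a })
  }

∑-∑-comm : (s : Summable A) (t : Summable B) (f : A → B → ℕ) →
           ∑ s (λ a → ∑ t (f a)) ≡ ∑ t (λ b → ∑ s (λ a → f a b))
∑-∑-comm s t f = ∑-exchange s (∑-additive t) f

Σ-↔-Fin-∑ : (s : Summable A) {P : A → Set} {f : A → ℕ} →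
            (∀ a → P a ↔ Fin (f a)) → Σ A P ↔ Fin (∑ s f)
Σ-↔-Fin-∑ none h = mk↔ₛ′ (λ ()) (λ ()) (λ ()) (λ ())
Σ-↔-Fin-∑ single h = h tt ↔-∘ mk↔ₛ′ proj₂ (tt ,_) (λ _ → refl) (λ _ → refl)
Σ-↔-Fin-∑ (s ⊕ t) h =
  (↔-sym Fin.+↔⊎ ↔-∘ (Σ-↔-Fin-∑ s (h ∘ inj₁) ⊎-↔ Σ-↔-Fin-∑ t (h ∘ inj₂))) ↔-∘
  mk↔ₛ′ (λ { (inj₁ a , x) → inj₁ (a , x) ; (inj₂ b , x) → inj₂ (b , x) })
        (λ { (inj₁ (a , x)) → inj₁ a , x ; (inj₂ (b , x)) → inj₂ b , x })
        (λ { (inj₁ _) → refl ; (inj₂ _) → refl })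
        (λ { (inj₁ _ , _) → refl ; (inj₂ _ , _) → refl })
Σ-↔-Fin-∑ (s ⊗ t) h =
  Σ-↔-Fin-∑ s (λ a → Σ-↔-Fin-∑ t (λ b → h (a , b))) ↔-∘
  mk↔ₛ′ (λ { ((a , b) , x) → a , b , x }) (λ { (a , b , x) → (a , b) , x }) (λ _ → refl) (λ _ → refl)
Σ-↔-Fin-∑ (via e s) h = Σ-↔-Fin-∑ s (h ∘ Inverse.to e) ↔-∘ ↔-sym (Σ-↔ e (↔-id _))

bool : Summable Bool
bool = via (mk↔ₛ′ (λ { (inj₁ _) → true ; (inj₂ _) → false })
                  (λ { true → inj₁ tt ; false → inj₂ tt })
                  (λ { true → refl ; false → refl })
                  (λ { (inj₁ _) → refl ; (inj₂ _) → refl }))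
           (single ⊕ single)

maybe : Summable A → Summable (Maybe A)
maybe s = via (mk↔ₛ′ (λ { (inj₁ _) → nothing ; (inj₂ a) → just a })
                     (λ { nothing → inj₁ tt ; (just a) → inj₂ a })
                     (λ { nothing → refl ; (just _) → refl })
                     (λ { (inj₁ _) → refl ; (inj₂ _) → refl }))
              (single ⊕ s)

fin : ∀ n → Summable (Fin n)
fin zero    = via (↔-sym Fin.0↔⊥) none
fin (suc n) = via (mk↔ₛ′ (λ { (inj₁ _) → zero ; (inj₂ i) → suc i })
                         (λ { zero → inj₁ tt ; (suc i) → inj₂ i })
                         (λ { zero → refl ; (suc _) → refl })
                         (λ { (inj₁ _) → refl ; (inj₂ _) → refl }))
                  (single ⊕ fin n)

vec : Summable A → ∀ n → Summable (Vec A n)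
vec s zero    = via (mk↔ₛ′ (λ _ → []) (λ _ → tt) (λ { [] → refl }) (λ _ → refl)) single
vec s (suc n) = via (mk↔ₛ′ (λ { (a , v) → a ∷ v }) (λ { (a ∷ v) → a , v })
                           (λ { (_ ∷ _) → refl }) (λ _ → refl))
                    (s ⊗ vec s n)

-- Products, indicators and the distributive law

∏ : ∀ n → (Fin n → ℕ) → ℕ
∏ zero    f = 1
∏ (suc n) f = f zero * ∏ n (f ∘ suc)

∏-cong : ∀ n {f g : Fin n → ℕ} → (∀ i → f i ≡ g i) → ∏ n f ≡ ∏ n g
∏-cong zero    h = refl
∏-cong (suc n) h = cong₂ _*_ (h zero) (∏-cong n (h ∘ suc))

-- The entries of a vector are chosen independently. Hence a condition imposed on each entry
-- separately yields a product of numbers of choices.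
∑-∏ : (s : Summable A) → ∀ n (g : Fin n → A → ℕ) →
      ∑ (vec s n) (λ v → ∏ n (λ i → g i (lookup v i))) ≡ ∏ n (λ i → ∑ s (g i))
∑-∏ s zero    g = refl
∑-∏ s (suc n) g = begin
  ∑ s (λ a → ∑ (vec s n) (λ v → g zero a * ∏ n (λ i → g (suc i) (lookup v i))))
    ≡⟨ ∑-cong s (λ a → trans (∑-*ˡ (vec s n) (g zero a) _)
                             (cong (g zero a *_) (∑-∏ s n (g ∘ suc)))) ⟩
  ∑ s (λ a → g zero a * ∏ n (λ i → ∑ s (g (suc i))))
    ≡⟨ ∑-*ʳ s _ (g zero) ⟩
  ∑ s (g zero) * ∏ n (λ i → ∑ s (g (suc i))) ∎

𝟙 : Bool → ℕ
𝟙 true  = 1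
𝟙 false = 0

𝟙-∧ : ∀ b c → 𝟙 (b ∧ c) ≡ 𝟙 b * 𝟙 c
𝟙-∧ true  c = sym (+-identityʳ (𝟙 c))
𝟙-∧ false c = refl

≡true-↔-Fin-𝟙 : ∀ b → (b ≡ true) ↔ Fin (𝟙 b)
≡true-↔-Fin-𝟙 true  = mk↔ₛ′ (λ _ → zero) (λ _ → refl) (λ { zero → refl }) (λ { refl → refl })
≡true-↔-Fin-𝟙 false = mk↔ₛ′ (λ ()) (λ ()) (λ ()) (λ ())

every : ∀ n → (Fin n → Bool) → Bool
every zero    P = true
every (suc n) P = P zero ∧ every n (P ∘ suc)

𝟙-every : ∀ n (P : Fin n → Bool) → 𝟙 (every n P) ≡ ∏ n (𝟙 ∘ P)
𝟙-every zero    P = refl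
𝟙-every (suc n) P = trans (𝟙-∧ (P zero) _) (cong (𝟙 (P zero) *_) (𝟙-every n (P ∘ suc)))

-- Splitting words over A ⊎ B into their two subwords

∑ᴸ : Summable A → ℕ → (List A → ℕ) → ℕ
∑ᴸ s n F = ∑ (vec s n) (F ∘ toList)

lefts : List (A ⊎ B) → List A
lefts = mapMaybe isInj₁

rights : List (A ⊎ B) → List B
rights = mapMaybe isInj₂

-- bin N K = Σᵢ (N choose i) K i (N − i); the recursion is Pascal's rule.
bin : ℕ → (ℕ → ℕ → ℕ) → ℕ
bin zero    K = K 0 0
bin (suc n) K = bin n (λ i j → K (suc i) j) + bin n (λ i j → K i (suc j))

bin-cong : ∀ n {K K′ : ℕ → ℕ → ℕ} → (∀ i j → i + j ≡ n → K i j ≡ K′ i j) → bin n K ≡ bin n K′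
bin-cong zero    h = h 0 0 refl
bin-cong (suc n) h = cong₂ _+_
  (bin-cong n λ i j e → h (suc i) j (cong suc e))
  (bin-cong n λ i j e → h i (suc j) (trans (+-suc i j) (cong suc e)))

bin-+ : ∀ n (K K′ : ℕ → ℕ → ℕ) → bin n (λ i j → K i j + K′ i j) ≡ bin n K + bin n K′
bin-+ zero    K K′ = refl
bin-+ (suc n) K K′ =
  trans (cong₂ _+_ (bin-+ n _ _) (bin-+ n _ _))
        (+-interchange (bin n (λ i j → K (suc i) j)) (bin n (λ i j → K′ (suc i) j))
                        (bin n (λ i j → K i (suc j))) (bin n (λ i j → K′ i (suc j))))

bin-*ˡ : ∀ n c (K : ℕ → ℕ → ℕ) → bin n (λ i j → c * K i j) ≡ c * bin n K
bin-*ˡ zero    c K = refl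
bin-*ˡ (suc n) c K = trans (cong₂ _+_ (bin-*ˡ n c _) (bin-*ˡ n c _)) (sym (*-distribˡ-+ c _ _))

∑-bin : (s : Summable A) → ∀ n (K : A → ℕ → ℕ → ℕ) →
        ∑ s (λ a → bin n (K a)) ≡ bin n (λ i j → ∑ s (λ a → K a i j))
∑-bin s zero    K = refl
∑-bin s (suc n) K = trans (φ-+ (∑-additive s) _ _)
  (cong₂ _+_ (∑-bin s n (λ a i j → K a (suc i) j)) (∑-bin s n (λ a i j → K a i (suc j))))

-- A word is determined by its two subwords and by the positions of the left letters, and `bin`
-- counts these positions. Reading the first letter gives the two halves of Pascal's rule.
∑ᴸ-⊕ : (s : Summable A) (t : Summable B) → ∀ n (G : List A → List B → ℕ) →
       ∑ᴸ (s ⊕ t) n (λ l → G (lefts l) (rights l)) ≡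
       bin n (λ i j → ∑ᴸ s i (λ as → ∑ᴸ t j (λ bs → G as bs)))
∑ᴸ-⊕ s t zero    G = refl
∑ᴸ-⊕ s t (suc n) G = cong₂ _+_
  (trans (∑-cong s λ a → ∑ᴸ-⊕ s t n (λ as bs → G (a ∷ as) bs))
         (∑-bin s n _))
  (begin
    ∑ t (λ b → ∑ᴸ (s ⊕ t) n (λ l → G (lefts l) (b ∷ rights l)))
      ≡⟨ ∑-cong t (λ b → ∑ᴸ-⊕ s t n (λ as bs → G as (b ∷ bs))) ⟩
    ∑ t (λ b → bin n (λ i j → ∑ᴸ s i (λ as → ∑ᴸ t j (λ bs → G as (b ∷ bs)))))
      ≡⟨ ∑-bin t n _ ⟩
    bin n (λ i j → ∑ t (λ b → ∑ᴸ s i (λ as → ∑ᴸ t j (λ bs → G as (b ∷ bs)))))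
      ≡⟨ bin-cong n (λ i j _ → ∑-∑-comm t (vec s i) _) ⟩
    bin n (λ i j → ∑ᴸ s i (λ as → ∑ᴸ t (suc j) (λ bs → G as bs))) ∎)

-- The absorption identity: `i` times (N choose i) is N times (N - 1 choose i - 1), here with N = n
-- + 1.
bin-absorb : ∀ n (K : ℕ → ℕ → ℕ) →
             bin (suc n) (λ i j → i * K i j) ≡ suc n * bin n (λ i j → K (suc i) j)
bin-absorb zero K = lem (K 1 0) where
  lem : ∀ x → 1 * x + 0 ≡ 1 * x
  lem = solve-∀
bin-absorb (suc n) K = begin
  bin (suc n) (λ i j → suc i * K (suc i) j) + bin (suc n) (λ i j → i * K i (suc j))
    ≡⟨ cong₂ _+_ (bin-+ (suc n) (λ i j → K (suc i) j) (λ i j → i * K (suc i) j))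
                 (bin-absorb n (λ i j → K i (suc j))) ⟩
  bin (suc n) (λ i j → K (suc i) j) + bin (suc n) (λ i j → i * K (suc i) j) + suc n * y
    ≡⟨ cong (λ z → x + y + z + suc n * y) (bin-absorb n (λ i j → K (suc i) j)) ⟩
  x + y + suc n * x + suc n * y
    ≡⟨ lem n x y ⟩
  suc (suc n) * bin (suc n) (λ i j → K (suc i) j) ∎
  where
  x = bin n (λ i j → K (suc (suc i)) j)
  y = bin n (λ i j → K (suc i) (suc j))
  lem : ∀ n x y → x + y + suc n * x + suc n * y ≡ suc (suc n) * (x + y)
  lem = solve-∀

binomial : ∀ n x y → bin n (λ i j → x ^ i * y ^ j) ≡ (x + y) ^ n
binomial zero    x y = refl
binomial (suc n) x y = begin
  bin n (λ i j → x ^ suc i * y ^ j) + bin n (λ i j → x ^ i * y ^ suc j)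
    ≡⟨ cong₂ _+_ (trans (bin-cong n λ i j _ → *-assoc x (x ^ i) (y ^ j)) (bin-*ˡ n x _))
                 (trans (bin-cong n λ i j _ → *-left-comm (x ^ i) y (y ^ j)) (bin-*ˡ n y _)) ⟩
  x * bin n _ + y * bin n _
    ≡⟨ cong (λ z → x * z + y * z) (binomial n x y) ⟩
  x * (x + y) ^ n + y * (x + y) ^ n
    ≡⟨ *-distribʳ-+ _ x y ⟨
  (x + y) ^ suc n ∎

∏ᴸ : (A → ℕ) → List A → ℕ
∏ᴸ f []       = 1
∏ᴸ f (x ∷ xs) = f x * ∏ᴸ f xs

count : (A → Bool) → List A → ℕ
count P []       = 0
count P (x ∷ xs) = 𝟙 (P x) + count P xs

∏ᴸ-⊎ : (f : A ⊎ B → ℕ) → ∀ xs → ∏ᴸ f xs ≡ ∏ᴸ (f ∘ inj₁) (lefts xs) * ∏ᴸ (f ∘ inj₂) (rights xs)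
∏ᴸ-⊎ f []            = refl
∏ᴸ-⊎ f (inj₁ a ∷ xs) = trans (cong (f (inj₁ a) *_) (∏ᴸ-⊎ f xs)) (sym (*-assoc (f (inj₁ a)) _ _))
∏ᴸ-⊎ f (inj₂ b ∷ xs) = trans (cong (f (inj₂ b) *_) (∏ᴸ-⊎ f xs))
  (*-left-comm (f (inj₂ b)) (∏ᴸ (f ∘ inj₁) (lefts xs)) (∏ᴸ (f ∘ inj₂) (rights xs)))

count-⊎ : (P : A ⊎ B → Bool) → ∀ xs →
          count P xs ≡ count (P ∘ inj₁) (lefts xs) + count (P ∘ inj₂) (rights xs)
count-⊎ P []            = refl
count-⊎ P (inj₁ a ∷ xs) = trans (cong (𝟙 (P (inj₁ a)) +_) (count-⊎ P xs)) (sym (+-assoc (𝟙 (P (inj₁ a))) _ _))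
count-⊎ P (inj₂ b ∷ xs) = trans (cong (𝟙 (P (inj₂ b)) +_) (count-⊎ P xs))
  (+-left-comm (𝟙 (P (inj₂ b))) (count (P ∘ inj₁) (lefts xs)) (count (P ∘ inj₂) (rights xs)))

∏ᴸ-const : ∀ r (xs : List A) → ∏ᴸ (λ _ → r) xs ≡ r ^ length xs
∏ᴸ-const r []       = refl
∏ᴸ-const r (x ∷ xs) = cong (r *_) (∏ᴸ-const r xs)

∏ᴸ-cong : {f g : A → ℕ} → (∀ x → f x ≡ g x) → ∀ xs → ∏ᴸ f xs ≡ ∏ᴸ g xs
∏ᴸ-cong h []       = refl
∏ᴸ-cong h (x ∷ xs) = cong₂ _*_ (h x) (∏ᴸ-cong h xs)

count-true : (xs : List A) → count (λ _ → true) xs ≡ length xs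
count-true []       = refl
count-true (x ∷ xs) = cong suc (count-true xs)

count-false : (xs : List A) → count (λ _ → false) xs ≡ 0
count-false []       = refl
count-false (x ∷ xs) = count-false xs

-- Forests with prescribed roots, counted by layers

-- Nested sums in place of `Fin h`, so that splitting off the first layer is an instance of `∑ᴸ-⊕`.
Lev : ℕ → Set
Lev zero    = ⊥
Lev (suc h) = ⊤ ⊎ Lev h

lev : ∀ h → Summable (Lev h)
lev zero    = none
lev (suc h) = single ⊕ lev h

depth : ∀ h → Lev h → ℕ
depth (suc h) (inj₁ _) = 0
depth (suc h) (inj₂ b) = suc (depth h b)

-- The number of possible parents of a vertex at a given depth; the `r` prescribed roots lie just
-- above depth 0.
layerAbove : ∀ h → ℕ → List (Lev h) → ℕ → ℕ
layerAbove h r bs zero    = r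
layerAbove h r bs (suc i) = count (λ b → depth h b ≡ᵇ i) bs

layerWeight : ∀ h → ℕ → List (Lev h) → ℕ
layerWeight h r bs = ∏ᴸ (layerAbove h r bs ∘ depth h) bs

layerAbove-suc : ∀ h r bs i →
  layerAbove (suc h) r bs (suc i) ≡ layerAbove h (length (lefts bs)) (rights bs) i
layerAbove-suc h r bs zero    = trans (count-⊎ _ bs)
  (trans (cong₂ _+_ (count-true (lefts bs)) (count-false (rights bs))) (+-identityʳ _))
layerAbove-suc h r bs (suc i) = trans (count-⊎ _ bs) (cong₂ _+_ (count-false (lefts bs)) refl)

-- Each vertex of the first layer picks one of the `r` roots; the first layer then serves as the set
-- of roots for the remaining layers.
layerWeight-suc : ∀ h r bs →
  layerWeight (suc h) r bs ≡
  r ^ length (lefts bs) * layerWeight h (length (lefts bs)) (rights bs)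
layerWeight-suc h r bs = trans (∏ᴸ-⊎ _ bs)
  (cong₂ _*_ (∏ᴸ-const r (lefts bs))
             (∏ᴸ-cong (λ b → layerAbove-suc h r bs (depth h b)) (rights bs)))

layered : ℕ → ℕ → ℕ → ℕ
layered h n r = ∑ᴸ (lev h) n (layerWeight h r)

∑-vec-single : ∀ n c → ∑ (vec single n) (λ _ → c) ≡ c
∑-vec-single zero    c = refl
∑-vec-single (suc n) c = ∑-vec-single n c

layered-suc : ∀ h n r → layered (suc h) n r ≡ bin n (λ i j → r ^ i * layered h j i)
layered-suc h n r = begin
  ∑ᴸ (lev (suc h)) n (layerWeight (suc h) r)
    ≡⟨ ∑-cong (vec (lev (suc h)) n) (λ v → layerWeight-suc h r (toList v)) ⟩
  ∑ᴸ (single ⊕ lev h) n (λ l → G (lefts l) (rights l))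
    ≡⟨ ∑ᴸ-⊕ single (lev h) n G ⟩
  bin n (λ i j → ∑ᴸ single i (λ as → ∑ᴸ (lev h) j (G as)))
    ≡⟨ bin-cong n (λ i j _ → begin
         ∑ᴸ single i (λ as → ∑ᴸ (lev h) j (G as))
           ≡⟨ ∑-cong (vec single i) (λ v → trans
                (cong (λ l → ∑ᴸ (lev h) j (λ bs → r ^ l * layerWeight h l bs)) (Vec.length-toList v))
                (∑-*ˡ (vec (lev h) j) (r ^ i) _)) ⟩
         ∑ᴸ single i (λ _ → r ^ i * layered h j i)
           ≡⟨ ∑-vec-single i _ ⟩
         r ^ i * layered h j i ∎) ⟩
  bin n (λ i j → r ^ i * layered h j i) ∎
  where
  G : List ⊤ → List (Lev h) → ℕ
  G as bs = r ^ length as * layerWeight h (length as) bs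

bin-0 : ∀ n → bin n (λ _ _ → 0) ≡ 0
bin-0 zero    = refl
bin-0 (suc n) = cong₂ _+_ (bin-0 n) (bin-0 n)

layered-no-roots : ∀ h n → layered h (suc n) 0 ≡ 0
layered-no-roots zero    n = refl
layered-no-roots (suc h) n = trans (layered-suc h (suc n) 0)
  (trans (bin-cong (suc n) vanish) (bin-0 (suc n)))
  where
  vanish : ∀ i j → i + j ≡ suc n → 0 ^ i * layered h j i ≡ 0
  vanish zero    j refl = trans (+-identityʳ _) (layered-no-roots h n)
  vanish (suc i) j _    = refl

-- The number of forests on `r + n` labelled vertices with `r` prescribed roots. The separate case
-- `n = 0` avoids a negative exponent.
forests : ℕ → ℕ → ℕ
forests zero    r = 1
forests (suc n) r = r * (r + suc n) ^ n

forests-scaled : ∀ i j n → i + j ≡ suc n → suc n * forests j i ≡ i * suc n ^ j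
forests-scaled i zero    n e = cong (_* 1) (trans (sym e) (+-identityʳ i))
forests-scaled i (suc j) n e =
  trans (cong (λ z → suc n * (i * z ^ j)) e) (*-left-comm (suc n) i (suc n ^ j))

-- A forest on `n` further vertices has at most `n` layers below its roots, so `h ≥ n` layers
-- capture all. Multiplying by `suc n` brings both cases of `forests` to the one form
-- `i * suc n ^ j`; then absorption and the binomial theorem evaluate the sum over the size `i` of
-- the first layer.
layered≡forests : ∀ h n r → n ≤ h → layered h n r ≡ forests n r
layered≡forests h       zero    r _       = refl
layered≡forests (suc h) (suc n) r (s≤s n≤h) = *-cancelˡ-≡ _ _ (suc n) (begin
  suc n * layered (suc h) (suc n) r
    ≡⟨ cong (suc n *_) (layered-suc h (suc n) r) ⟩
  suc n * bin (suc n) (λ i j → r ^ i * layered h j i)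
    ≡⟨ bin-*ˡ (suc n) (suc n) (λ i j → r ^ i * layered h j i) ⟨
  bin (suc n) (λ i j → suc n * (r ^ i * layered h j i))
    ≡⟨ bin-cong (suc n) term ⟩
  bin (suc n) (λ i j → i * (r ^ i * suc n ^ j))
    ≡⟨ bin-absorb n (λ i j → r ^ i * suc n ^ j) ⟩
  suc n * bin n (λ i j → r ^ suc i * suc n ^ j)
    ≡⟨ cong (suc n *_) (trans (bin-cong n λ i j _ → *-assoc r (r ^ i) (suc n ^ j)) (bin-*ˡ n r _)) ⟩
  suc n * (r * bin n (λ i j → r ^ i * suc n ^ j))
    ≡⟨ cong (λ z → suc n * (r * z)) (binomial n r (suc n)) ⟩
  suc n * (r * (r + suc n) ^ n) ∎)
  where
  term : ∀ i j → i + j ≡ suc n → suc n * (r ^ i * layered h j i) ≡ i * (r ^ i * suc n ^ j)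
  -- With an empty first layer the remaining vertices have no roots to hang from.
  term zero    j refl = trans (cong (λ z → suc n * (1 * z)) (layered-no-roots h n)) (*-zeroʳ (suc n))
  term (suc i) j e    = begin
    suc n * (r ^ suc i * layered h j (suc i))
      -- A nonempty first layer leaves `j ≤ n` vertices, for which `h` layers suffice.
      ≡⟨ cong (λ z → suc n * (r ^ suc i * z)) (layered≡forests h j (suc i)
           (≤-trans (m≤n+m j i) (≤-trans (≤-reflexive (suc-injective e)) n≤h))) ⟩
    suc n * (r ^ suc i * forests j (suc i))
      ≡⟨ *-left-comm (suc n) (r ^ suc i) _ ⟩
    r ^ suc i * (suc n * forests j (suc i))
      ≡⟨ cong (r ^ suc i *_) (forests-scaled (suc i) j n e) ⟩
    r ^ suc i * (suc i * suc n ^ j)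
      ≡⟨ *-left-comm (r ^ suc i) (suc i) _ ⟩
    suc i * (r ^ suc i * suc n ^ j) ∎

-- Attaching leaves to the maximal decreasing subtree

-- Words list the labels increasingly, true marking level 0 and false level 1;
-- d is the number of vertices of level 0 that precede the word.
childWeight : ℕ → List Bool → ℕ
childWeight d []           = 1
childWeight d (true  ∷ as) = childWeight (suc d) as
childWeight d (false ∷ as) = d * childWeight d as

-- Counts the parents available on level 0: `count id as` is the number of larger vertices of that
-- level, and the indicator gives the largest one its single choice, to be the root.
decWeight : List Bool → ℕ
decWeight []           = 1
decWeight (true  ∷ as) = (𝟙 (count id as ≡ᵇ 0) + count id as) * decWeight as
decWeight (false ∷ as) = decWeight as

-- Among c vertices of level 0 in increasing order the numbers of choices are c - 1, ..., 1, and
-- then 1 for the root. Truncated subtraction covers c = 0.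
decWeight≡! : ∀ as → decWeight as ≡ (count id as ∸ 1) !
decWeight≡! [] = refl
decWeight≡! (false ∷ as) = decWeight≡! as
decWeight≡! (true  ∷ as) rewrite decWeight≡! as with count id as
... | zero  = refl
... | suc c = refl

-- For `d = 0` this counts partitions of `j` elements into `a` blocks: `true` opens a block and
-- `false` joins one of those already open. The recursion on the first letter needs a general number
-- `d` of blocks open at the start.
stir : ℕ → ℕ → ℕ → ℕ
stir j d a = ∑ᴸ bool j (λ as → 𝟙 (d + count id as ≡ᵇ a) * childWeight d as)

stir-head : ∀ j d a → stir (suc j) d a ≡ stir j (suc d) a + d * stir j d a
stir-head j d a = cong₂ _+_
  (∑-cong (vec bool j) λ v →
    cong (λ z → 𝟙 (z ≡ᵇ a) * childWeight (suc d) (toList v)) (+-suc d (count id (toList v))))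
  (trans (∑-cong (vec bool j) λ v → *-left-comm (𝟙 (d + count id (toList v) ≡ᵇ a)) d (childWeight d (toList v)))
         (∑-*ˡ (vec bool j) d _))

≡ᵇ-true : ∀ m n → (m ≡ᵇ n) ≡ true → m ≡ n
≡ᵇ-true m n e = ≡ᵇ⇒≡ m n (Equivalence.from T-≡ e)

true-≡ᵇ : ∀ {a b} → a ≡ b → (a ≡ᵇ b) ≡ true
true-≡ᵇ {a} {b} p = Equivalence.to T-≡ (≡⇒≡ᵇ a b p)

*𝟙-≡ᵇ : ∀ m n → m * 𝟙 (m ≡ᵇ n) ≡ n * 𝟙 (m ≡ᵇ n)
*𝟙-≡ᵇ m n with m ≡ᵇ n in e
... | true  = cong (_* 1) (≡ᵇ-true m n e)
... | false = trans (*-zeroʳ m) (sym (*-zeroʳ n))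

-- stir-head reads the first letter of the words; the Stirling recurrence reads the
-- last one, and the two one-letter operators commute.
stir-tail : ∀ j d a → stir (suc j) d (suc a) ≡ stir j d a + suc a * stir j d (suc a)
stir-tail zero d a = trans (stir-head 0 d (suc a)) (cong (stir 0 d a +_) base)
  where
  -- On the empty word the indicator vanishes unless `d = suc a`.
  base : d * stir 0 d (suc a) ≡ suc a * stir 0 d (suc a)
  base rewrite +-identityʳ d | *-identityʳ (𝟙 (d ≡ᵇ suc a)) = *𝟙-≡ᵇ d (suc a)
stir-tail (suc j) d a = begin
  stir (suc (suc j)) d (suc a)
    ≡⟨ stir-head (suc j) d (suc a) ⟩
  stir (suc j) (suc d) (suc a) + d * stir (suc j) d (suc a)
    ≡⟨ cong₂ (λ x y → x + d * y) (stir-tail j (suc d) a) (stir-tail j d a) ⟩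
  stir j (suc d) a + suc a * stir j (suc d) (suc a) + d * (stir j d a + suc a * stir j d (suc a))
    ≡⟨ lem (stir j (suc d) a) (stir j (suc d) (suc a)) (stir j d a) (stir j d (suc a)) d a ⟩
  stir j (suc d) a + d * stir j d a + suc a * (stir j (suc d) (suc a) + d * stir j d (suc a))
    ≡⟨ cong₂ (λ x y → x + suc a * y) (stir-head j d a) (stir-head j d (suc a)) ⟨
  stir (suc j) d a + suc a * stir (suc j) d (suc a) ∎
  where
  lem : ∀ x y z w d a → x + suc a * y + d * (z + suc a * w) ≡ x + d * z + suc a * (y + d * w)
  lem = solve-∀

stir≡S₂ : ∀ j a → stir j 0 a ≡ S₂ j a
stir≡S₂ zero    zero    = refl
stir≡S₂ zero    (suc a) = refl
stir≡S₂ (suc j) zero    =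
  -- After a first `true` the count can no longer be 0, and a first `false` has weight 0.
  trans (stir-head j 0 0) (trans (+-identityʳ (stir j 1 0)) (φ-0 (∑-additive (vec bool j))))
stir≡S₂ (suc j) (suc a) = trans (stir-tail j 0 a)
  (trans (cong₂ (λ x y → x + suc a * y) (stir≡S₂ j a) (stir≡S₂ j (suc a))) (+-comm (S₂ j a) _))

-- Assembling the closed formula

sumUpTo : ℕ → (ℕ → ℕ) → ℕ
sumUpTo n f = sum (applyUpTo f n)

sumUpTo-cong : ∀ n {f g : ℕ → ℕ} → (∀ i → i < n → f i ≡ g i) → sumUpTo n f ≡ sumUpTo n g
sumUpTo-cong zero    h = refl
sumUpTo-cong (suc n) h = cong₂ _+_ (h 0 z<s) (sumUpTo-cong n λ i i<n → h (suc i) (s<s i<n))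

sumUpTo-+ : ∀ n (f g : ℕ → ℕ) → sumUpTo n (λ i → f i + g i) ≡ sumUpTo n f + sumUpTo n g
sumUpTo-+ zero    f g = refl
sumUpTo-+ (suc n) f g = trans (cong (f 0 + g 0 +_) (sumUpTo-+ n _ _))
  (+-interchange (f 0) (g 0) (sumUpTo n (f ∘ suc)) (sumUpTo n (g ∘ suc)))

sumUpTo-last : ∀ n (f : ℕ → ℕ) → sumUpTo (suc n) f ≡ sumUpTo n f + f n
sumUpTo-last zero    f = +-identityʳ (f 0)
sumUpTo-last (suc n) f =
  trans (cong (f 0 +_) (sumUpTo-last n (f ∘ suc))) (sym (+-assoc (f 0) _ _))

sumUpTo-drop : ∀ k n (f : ℕ → ℕ) → (∀ i → i < k → f i ≡ 0) →
               sumUpTo n f ≡ sumUpTo (n ∸ k) (λ i → f (k + i))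
sumUpTo-drop zero    n       f h = refl
sumUpTo-drop (suc k) zero    f h = refl
sumUpTo-drop (suc k) (suc n) f h =
  trans (cong (_+ sumUpTo n (f ∘ suc)) (h 0 z<s))
        (sumUpTo-drop k n (f ∘ suc) (λ i i<k → h (suc i) (s<s i<k)))

bin≡sum : ∀ n (K : ℕ → ℕ → ℕ) → bin n K ≡ sumUpTo (suc n) (λ i → (n C i) * K i (n ∸ i))
bin≡sum zero    K = sym (trans (+-identityʳ _) (+-identityʳ (K 0 0)))
bin≡sum (suc n) K = begin
  bin n (λ i j → K (suc i) j) + bin n (λ i j → K i (suc j))
    ≡⟨ cong₂ _+_ (bin≡sum n _) (bin≡sum n _) ⟩
  X + sumUpTo (suc n) (λ i → (n C i) * K i (suc (n ∸ i)))
    ≡⟨ cong (X +_) (sumUpTo-cong (suc n) λ i i≤n →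
         cong (λ z → (n C i) * K i z) (sym (+-∸-assoc 1 (s≤s⁻¹ i≤n)))) ⟩
  X + sumUpTo (suc n) f
    -- The sum is extended by the term `i = suc n`, which is 0 because of its binomial coefficient;
    -- its term at 0 can then be split off to align the rest with `X`.
    ≡⟨ cong (X +_) (trans (sumUpTo-last (suc n) f) (trans
         (cong (λ z → sumUpTo (suc n) f + z * K (suc n) (n ∸ n)) (k>n⇒nCk≡0 (n<1+n n)))
         (+-identityʳ _))) ⟨
  X + (f 0 + sumUpTo (suc n) (f ∘ suc))
    ≡⟨ +-left-comm X (f 0) _ ⟩
  f 0 + (X + sumUpTo (suc n) (f ∘ suc))
    ≡⟨ cong (f 0 +_) (sumUpTo-+ (suc n) (λ i → (n C i) * K (suc i) (n ∸ i)) (f ∘ suc)) ⟨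
  f 0 + sumUpTo (suc n) (λ i → (n C i) * K (suc i) (n ∸ i) + f (suc i))
    ≡⟨ cong (f 0 +_) (sumUpTo-cong (suc n) λ i _ →
         trans (sym (*-distribʳ-+ (K (suc i) (n ∸ i)) (n C i) (n C suc i)))
               (cong (_* K (suc i) (n ∸ i)) (nCk+nC[k+1]≡[n+1]C[k+1] n i))) ⟩
  sumUpTo (suc (suc n)) (λ i → (suc n C i) * K i (suc n ∸ i)) ∎
  where
  X = sumUpTo (suc n) (λ i → (n C i) * K (suc i) (n ∸ i))
  f : ℕ → ℕ
  f i = (n C i) * K i (suc n ∸ i)

S₂-< : ∀ {a b} → a < b → S₂ a b ≡ 0
S₂-< {zero}  {suc b} _         = refl
S₂-< {suc a} {suc b} (s<s a<b)
  rewrite S₂-< (m<n⇒m<1+n a<b) | S₂-< a<b = trans (+-identityʳ _) (*-zeroʳ b)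

-- The roots and the vertices below them number (m - k) + (n - m) = n - k together, which is the
-- base of the power. The convention for `m = n` is the value of `forests` at 0.
forests≡forestFactor : ∀ n k m → k ≤ m → m ≤ n → forests (n ∸ m) (m ∸ k) ≡ forestFactor n k m
forests≡forestFactor n k m k≤m m≤n with m ≡ᵇ n in e
... | true  = cong (λ z → forests z (m ∸ k)) (trans (cong (_∸ m) (sym (≡ᵇ-true m n e))) (n∸n≡0 m))
... | false with n ∸ m in e′
...   | zero  =
  contradiction (trans (sym (true-≡ᵇ (≤-antisym m≤n (m∸n≡0⇒m≤n e′)))) e) λ ()
...   | suc q = trans (*-comm (m ∸ k) _) (cong (λ z → z ^ q * (m ∸ k)) (begin
          m ∸ k + suc q     ≡⟨ cong (m ∸ k +_) e′ ⟨
          m ∸ k + (n ∸ m)   ≡⟨ +-comm (m ∸ k) _ ⟩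
          n ∸ m + (m ∸ k)   ≡⟨ +-∸-assoc (n ∸ m) k≤m ⟨
          n ∸ m + m ∸ k     ≡⟨ cong (_∸ k) (m∸n+n≡m m≤n) ⟩
          n ∸ k             ∎))

count-id+not : ∀ as → count id as + count not as ≡ length as
count-id+not []           = refl
count-id+not (true  ∷ as) = cong suc (count-id+not as)
count-id+not (false ∷ as) = trans (+-suc _ _) (cong suc (count-id+not as))

<∸⇒+< : ∀ k n {i} → i < n ∸ k → k + i < n
<∸⇒+< zero    n       p = p
<∸⇒+< (suc k) (suc n) p = s<s (<∸⇒+< k n p)

wordWeight : ∀ h k → List Bool → List (Lev h) → ℕ
wordWeight h k as bs =
  𝟙 (count id as ≡ᵇ suc k) * (decWeight as * childWeight 0 as * layerWeight h (count not as) bs)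

-- Once the word has `suc k` letters `true`, the choices on level 0 amount to `k !` and the number
-- of roots is `i ∸ suc k`, whatever the word. Only `childWeight` still varies, and it sums to a
-- Stirling number.
∑-wordWeight : ∀ h k i j → j ≤ h →
  ∑ᴸ bool i (λ as → ∑ᴸ (lev h) j (wordWeight h k as)) ≡ S₂ i (suc k) * (k ! * forests j (i ∸ suc k))
∑-wordWeight h k i j j≤h = begin
  ∑ᴸ bool i (λ as → ∑ᴸ (lev h) j (wordWeight h k as))
    ≡⟨ ∑-cong (vec bool i) (λ v → trans (pull (toList v)) (term (toList v) (Vec.length-toList v))) ⟩
  ∑ᴸ bool i (λ as → 𝟙 (count id as ≡ᵇ suc k) * childWeight 0 as * (k ! * forests j (i ∸ suc k)))
    ≡⟨ ∑-*ʳ (vec bool i) _ _ ⟩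
  stir i 0 (suc k) * (k ! * forests j (i ∸ suc k))
    ≡⟨ cong₂ _*_ (stir≡S₂ i (suc k)) refl ⟩
  S₂ i (suc k) * (k ! * forests j (i ∸ suc k)) ∎
  where
  pull : ∀ as → ∑ᴸ (lev h) j (wordWeight h k as) ≡
         𝟙 (count id as ≡ᵇ suc k) * (decWeight as * childWeight 0 as * forests j (count not as))
  pull as = trans (∑-*ˡ (vec (lev h) j) (𝟙 (count id as ≡ᵇ suc k)) _)
    (cong (𝟙 (count id as ≡ᵇ suc k) *_)
      (trans (∑-*ˡ (vec (lev h) j) (decWeight as * childWeight 0 as) _)
             (cong (decWeight as * childWeight 0 as *_) (layered≡forests h j (count not as) j≤h))))
  term : ∀ as → length as ≡ i →
         𝟙 (count id as ≡ᵇ suc k) * (decWeight as * childWeight 0 as * forests j (count not as)) ≡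
         𝟙 (count id as ≡ᵇ suc k) * childWeight 0 as * (k ! * forests j (i ∸ suc k))
  term as refl with count id as ≡ᵇ suc k in e
  ... | false = refl
  ... | true  = trans
    (cong₂ (λ x y → 1 * (x * childWeight 0 as * forests j y))
      (trans (decWeight≡! as) (cong (λ c → (c ∸ 1) !) c≡))
      (trans (sym (m+n∸m≡n (count id as) (count not as))) (cong₂ _∸_ (count-id+not as) c≡)))
    (lem (k !) (childWeight 0 as) (forests j (length as ∸ suc k)))
    where
    c≡ = ≡ᵇ-true (count id as) (suc k) e
    lem : ∀ x y z → 1 * (x * y * z) ≡ 1 * y * (x * z)
    lem = solve-∀

bin-wordWeight : ∀ h n k → suc n ≤ h →
  bin (suc n) (λ i j → ∑ᴸ bool i (λ as → ∑ᴸ (lev h) j (wordWeight h k as))) ≡ rhs n k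
bin-wordWeight h n k n<h = begin
  bin (suc n) (λ i j → ∑ᴸ bool i (λ as → ∑ᴸ (lev h) j (wordWeight h k as)))
    ≡⟨ bin-cong (suc n) (λ i j e →
         ∑-wordWeight h k i j (≤-trans (m≤n+m j i) (≤-trans (≤-reflexive e) n<h))) ⟩
  bin (suc n) (λ i j → S₂ i (suc k) * (k ! * forests j (i ∸ suc k)))
    ≡⟨ bin≡sum (suc n) (λ i j → S₂ i (suc k) * (k ! * forests j (i ∸ suc k))) ⟩
  -- The term `i = 0` computes to 0, since `S₂ 0 (suc k)` does; the others are indexed by `m` with
  -- `i = suc m`.
  sumUpTo (suc n) f
    ≡⟨ sumUpTo-drop k (suc n) f (λ m m<k → trans
         (cong (λ z → (suc n C suc m) * (z * (k ! * forests (n ∸ m) (m ∸ k)))) (S₂-< (s<s m<k)))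
         (*-zeroʳ (suc n C suc m))) ⟩
  sumUpTo (suc n ∸ k) (λ i → f (k + i))
    ≡⟨ sumUpTo-cong (suc n ∸ k) (λ i i< → trans
         (cong (λ z → (suc n C suc (k + i)) * (S₂ (suc (k + i)) (suc k) * (k ! * z)))
           (forests≡forestFactor n k (k + i) (m≤m+n k i) (s≤s⁻¹ (<∸⇒+< k (suc n) i<))))
         (lem (suc n C suc (k + i)) (S₂ (suc (k + i)) (suc k)) (k !) _)) ⟩
  sumUpTo (suc n ∸ k) (λ i → (suc n C suc (k + i)) * S₂ (suc (k + i)) (suc k) * k ! * forestFactor n k (k + i))
    ≡⟨ cong sum (map-upTo _ (suc n ∸ k)) ⟨
  rhs n k ∎
  where
  f : ℕ → ℕ
  f m = (suc n C suc m) * (S₂ (suc m) (suc k) * (k ! * forests (n ∸ m) (m ∸ k)))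
  lem : ∀ a b c d → a * (b * (c * d)) ≡ a * b * c * d
  lem = solve-∀

-- Parent maps with prescribed levels

Level : ℕ → Set
Level h = Bool ⊎ Lev h

level : ∀ h → Level h → ℕ
level h (inj₁ true)  = 0
level h (inj₁ false) = 1
level h (inj₂ b)     = suc (suc (depth h b))

-- Whether v can have parent u, when their levels are lv and lu.
edge : ℕ → ℕ → ℕ → ℕ → Bool
edge 0             lu v u = (v <ᵇ u) ∧ (lu ≡ᵇ 0)
edge 1             lu v u = (u <ᵇ v) ∧ (lu ≡ᵇ 0)
edge (suc (suc i)) lu v u = lu ≡ᵇ suc i

larger : ∀ {m} → (Fin m → ℕ) → Fin m → ℕ
larger {m} ℓ v = ∑ (fin m) λ u → 𝟙 ((toℕ v <ᵇ toℕ u) ∧ (ℓ u ≡ᵇ 0))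

smaller : ∀ {m} → (Fin m → ℕ) → Fin m → ℕ
smaller {m} ℓ v = ∑ (fin m) λ u → 𝟙 ((toℕ u <ᵇ toℕ v) ∧ (ℓ u ≡ᵇ 0))

-- The root is the largest vertex of level 0. Demanding this of every vertex without a parent also
-- excludes a second root.
admissible : ∀ {m} → (Fin m → ℕ) → Fin m → Maybe (Fin m) → Bool
admissible ℓ v nothing  = (ℓ v ≡ᵇ 0) ∧ (larger ℓ v ≡ᵇ 0)
admissible ℓ v (just u) = edge (ℓ v) (ℓ u) (toℕ v) (toℕ u)

-- Here `a` and `b` are the numbers of larger and smaller vertices of level 0, and `g i` is the size
-- of level `suc i`. The indicator accounts for the choice `nothing`.
parentCount : ℕ → ℕ → ℕ → (ℕ → ℕ) → ℕ
parentCount 0             a b g = 𝟙 (a ≡ᵇ 0) + a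
parentCount 1             a b g = b
parentCount (suc (suc i)) a b g = g i

∑-admissible : ∀ {m} (ℓ : Fin m → ℕ) v →
  ∑ (maybe (fin m)) (𝟙 ∘ admissible ℓ v) ≡
  parentCount (ℓ v) (larger ℓ v) (smaller ℓ v) (λ i → ∑ (fin m) λ u → 𝟙 (ℓ u ≡ᵇ suc i))
∑-admissible ℓ v with ℓ v
... | 0           = refl
... | 1           = refl
... | suc (suc i) = refl

∑-lookup : ∀ {m} (P : A → Bool) (xs : Vec A m) →
           ∑ (fin m) (λ u → 𝟙 (P (lookup xs u))) ≡ count P (toList xs)
∑-lookup P []       = refl
∑-lookup P (x ∷ xs) = cong (𝟙 (P x) +_) (∑-lookup P xs)

count-cong : {P Q : A → Bool} → (∀ x → P x ≡ Q x) → ∀ xs → count P xs ≡ count Q xs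
count-cong h []       = refl
count-cong h (x ∷ xs) = cong₂ _+_ (cong 𝟙 (h x)) (count-cong h xs)

count-level-0 : ∀ h xs → count (λ x → level h x ≡ᵇ 0) xs ≡ count id (lefts xs)
count-level-0 h xs = trans (count-⊎ _ xs)
  (trans (cong₂ _+_ (count-cong (λ { true → refl ; false → refl }) (lefts xs))
                    (count-false (rights xs)))
         (+-identityʳ _))

count-level-suc : ∀ h xs i →
  count (λ x → level h x ≡ᵇ suc i) xs ≡ layerAbove h (count not (lefts xs)) (rights xs) i
count-level-suc h xs zero = trans (count-⊎ _ xs)
  (trans (cong₂ _+_ (count-cong (λ { true → refl ; false → refl }) (lefts xs))
                    (count-false (rights xs)))
         (+-identityʳ _))
count-level-suc h xs (suc i) = trans (count-⊎ _ xs)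
  (cong₂ _+_ (trans (count-cong (λ { true → refl ; false → refl }) (lefts xs))
                    (count-false (lefts xs)))
             refl)

-- The induction removes the smallest label each time; `d` remembers how many vertices of level 0
-- were removed, all of them smaller than what is left.
∏-parentCount : ∀ h {m} (xs : Vec (Level h) m) d g →
  let ℓ = level h ∘ lookup xs in
  ∏ m (λ v → parentCount (ℓ v) (larger ℓ v) (d + smaller ℓ v) g) ≡
  decWeight (lefts (toList xs)) * childWeight d (lefts (toList xs)) *
  ∏ᴸ (g ∘ depth h) (rights (toList xs))
∏-parentCount h []                d g = refl
∏-parentCount h {suc m} (inj₁ true ∷ xs)  d g = begin
  (𝟙 (a ≡ᵇ 0) + a) * ∏ m (λ v → parentCount (ℓ v) (larger ℓ v) (d + suc (smaller ℓ v)) g)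
    -- All other labels exceed the first, so its `larger` counts every later vertex of level 0, and
    -- `smaller` rises by one for each of the others.
    ≡⟨ cong₂ (λ c z → (𝟙 (c ≡ᵇ 0) + c) * z)
         (trans (∑-lookup (λ x → level h x ≡ᵇ 0) xs) (count-level-0 h (toList xs)))
         (trans (∏-cong m λ v → cong (λ z → parentCount (ℓ v) (larger ℓ v) z g) (+-suc d (smaller ℓ v)))
                (∏-parentCount h xs (suc d) g)) ⟩
  (𝟙 (c ≡ᵇ 0) + c) * (decWeight as * childWeight (suc d) as * w)
    ≡⟨ lem (𝟙 (c ≡ᵇ 0) + c) (decWeight as) (childWeight (suc d) as) w ⟩
  (𝟙 (c ≡ᵇ 0) + c) * decWeight as * childWeight (suc d) as * w ∎
  where
  ℓ = level h ∘ lookup xs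
  a = ∑ (fin m) (λ u → 𝟙 (ℓ u ≡ᵇ 0))
  as = lefts (toList xs)
  c = count id as
  w = ∏ᴸ (g ∘ depth h) (rights (toList xs))
  lem : ∀ x y z w → x * (y * z * w) ≡ x * y * z * w
  lem = solve-∀
∏-parentCount h {suc m} (inj₁ false ∷ xs) d g = begin
  (d + ∑ (fin m) (λ _ → 0)) * ∏ m (λ v → parentCount (ℓ v) (larger ℓ v) (d + smaller ℓ v) g)
    ≡⟨ cong₂ _*_ (trans (cong (d +_) (φ-0 (∑-additive (fin m)))) (+-identityʳ d))
                 (∏-parentCount h xs d g) ⟩
  d * (decWeight as * childWeight d as * w)
    ≡⟨ lem d (decWeight as) (childWeight d as) w ⟩
  decWeight as * (d * childWeight d as) * w ∎
  where
  ℓ = level h ∘ lookup xs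
  as = lefts (toList xs)
  w = ∏ᴸ (g ∘ depth h) (rights (toList xs))
  lem : ∀ x y z w → x * (y * z * w) ≡ y * (x * z) * w
  lem = solve-∀
∏-parentCount h {suc m} (inj₂ b ∷ xs)     d g = trans
  (cong (g (depth h b) *_) (∏-parentCount h xs d g))
  (*-left-comm (g (depth h b)) (decWeight as * childWeight d as) (∏ᴸ (g ∘ depth h) (rights (toList xs))))
  where
  as = lefts (toList xs)

parentCount-cong : ∀ l a b {g g′ : ℕ → ℕ} → (∀ i → g i ≡ g′ i) →
                   parentCount l a b g ≡ parentCount l a b g′
parentCount-cong 0             a b h = refl
parentCount-cong 1             a b h = refl
parentCount-cong (suc (suc i)) a b h = h i

valid : ∀ {m} → (Fin m → ℕ) → Vec (Maybe (Fin m)) m → Bool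
valid {m} ℓ p = every m λ v → admissible ℓ v (lookup p v)

mdCount : ∀ {m} → (Fin m → ℕ) → ℕ
mdCount {m} ℓ = ∑ (fin m) λ v → 𝟙 (ℓ v ≡ᵇ 0)

∑-valid : ∀ h k {m} (xs : Vec (Level h) m) →
  let ℓ = level h ∘ lookup xs in
  ∑ (vec (maybe (fin m)) m) (λ p → 𝟙 (valid ℓ p ∧ (mdCount ℓ ≡ᵇ suc k))) ≡
  wordWeight h k (lefts (toList xs)) (rights (toList xs))
∑-valid h k {m} xs = begin
  ∑ ps (λ p → 𝟙 (valid ℓ p ∧ (mdCount ℓ ≡ᵇ suc k)))
    ≡⟨ ∑-cong ps (λ p → trans (𝟙-∧ (valid ℓ p) _) (*-comm (𝟙 (valid ℓ p)) _)) ⟩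
  ∑ ps (λ p → 𝟙 (mdCount ℓ ≡ᵇ suc k) * 𝟙 (valid ℓ p))
    ≡⟨ ∑-*ˡ ps (𝟙 (mdCount ℓ ≡ᵇ suc k)) (λ p → 𝟙 (valid ℓ p)) ⟩
  𝟙 (mdCount ℓ ≡ᵇ suc k) * ∑ ps (λ p → 𝟙 (valid ℓ p))
    ≡⟨ cong₂ (λ c z → 𝟙 (c ≡ᵇ suc k) * z)
         (trans (∑-lookup (λ x → level h x ≡ᵇ 0) xs) (count-level-0 h l)) (begin
      ∑ ps (λ p → 𝟙 (valid ℓ p))
        ≡⟨ ∑-cong ps (λ p → 𝟙-every m λ v → admissible ℓ v (lookup p v)) ⟩
      ∑ ps (λ p → ∏ m λ v → 𝟙 (admissible ℓ v (lookup p v)))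
        ≡⟨ ∑-∏ (maybe (fin m)) m (λ v x → 𝟙 (admissible ℓ v x)) ⟩
      ∏ m (λ v → ∑ (maybe (fin m)) (𝟙 ∘ admissible ℓ v))
        ≡⟨ ∏-cong m (λ v → trans (∑-admissible ℓ v)
             (parentCount-cong (ℓ v) (larger ℓ v) (smaller ℓ v) λ i →
               trans (∑-lookup (λ x → level h x ≡ᵇ suc i) xs) (count-level-suc h l i))) ⟩
      ∏ m (λ v → parentCount (ℓ v) (larger ℓ v) (smaller ℓ v)
                   (layerAbove h (count not (lefts l)) (rights l)))
        ≡⟨ ∏-parentCount h xs 0 _ ⟩
      decWeight (lefts l) * childWeight 0 (lefts l) * layerWeight h (count not (lefts l)) (rights l) ∎) ⟩
  wordWeight h k (lefts l) (rights l) ∎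
  where
  ℓ = level h ∘ lookup xs
  l = toList xs
  ps = vec (maybe (fin m)) m

-- Level labellings of rooted trees

Labelled : ℕ → ℕ → ℕ → Set
Labelled h n k = Σ (Vec (Level h) (suc n)) λ xs → Σ (ParentMap n) λ p →
  (valid (level h ∘ lookup xs) p ∧ (mdCount (level h ∘ lookup xs) ≡ᵇ suc k)) ≡ true

Labelled-↔-Fin : ∀ h n k → suc n ≤ h → Labelled h n k ↔ Fin (rhs n k)
Labelled-↔-Fin h n k n<h = subst (λ c → Labelled h n k ↔ Fin c) total
  (Σ-↔-Fin-∑ words λ xs → Σ-↔-Fin-∑ (vec (maybe (fin (suc n))) (suc n)) λ p → ≡true-↔-Fin-𝟙 _)
  where
  words = vec (bool ⊕ lev h) (suc n)
  total : ∑ words (λ xs → ∑ (vec (maybe (fin (suc n))) (suc n)) λ p →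
            𝟙 (valid (level h ∘ lookup xs) p ∧ (mdCount (level h ∘ lookup xs) ≡ᵇ suc k))) ≡ rhs n k
  total = trans (∑-cong words (∑-valid h k))
    (trans (∑ᴸ-⊕ bool (lev h) (suc n) (wordWeight h k)) (bin-wordWeight h n k n<h))

-- Counting vertices

#true : ∀ m → (Fin m → Bool) → ℕ
#true m P = ∑ (fin m) (𝟙 ∘ P)

length-filter-tabulate : ∀ m (P : A → Bool) (g : Fin m → A) →
  length (filter (λ v → T? (P v)) (tabulate g)) ≡ #true m (P ∘ g)
length-filter-tabulate zero    P g = refl
length-filter-tabulate (suc m) P g with P (g zero)
... | true  = cong suc (length-filter-tabulate m P (g ∘ suc))
... | false = length-filter-tabulate m P (g ∘ suc)

countV≡#true : ∀ {n} (P : Fin (suc n) → Bool) → countV P ≡ #true (suc n) P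
countV≡#true {n} P = length-filter-tabulate (suc n) P id

#true-≤ : ∀ m P → #true m P ≤ m
#true-≤ zero    P = z≤n
#true-≤ (suc m) P with P zero
... | true  = s≤s (#true-≤ m (P ∘ suc))
... | false = m≤n⇒m≤1+n (#true-≤ m (P ∘ suc))

#true-full : ∀ m P → #true m P ≡ m → ∀ v → P v ≡ true
#true-full (suc m) P e v with P zero in eq
#true-full (suc m) P e v       | false = contradiction (≤-trans (≤-reflexive (sym e)) (#true-≤ m (P ∘ suc))) 1+n≰n
#true-full (suc m) P e zero    | true  = eq
#true-full (suc m) P e (suc v) | true  = #true-full m (P ∘ suc) (suc-injective e) v

#true-all : ∀ m {P} → (∀ v → P v ≡ true) → #true m P ≡ m
#true-all zero    h = refl
#true-all (suc m) h = cong₂ _+_ (cong 𝟙 (h zero)) (#true-all m (h ∘ suc))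

#true-none : ∀ m {P} → (∀ v → P v ≡ false) → #true m P ≡ 0
#true-none zero    h = refl
#true-none (suc m) h = cong₂ _+_ (cong 𝟙 (h zero)) (#true-none m (h ∘ suc))

#true-empty : ∀ m P → #true m P ≡ 0 → ∀ v → P v ≡ false
#true-empty (suc m) P e v with P zero in eq
#true-empty (suc m) P e zero    | false = eq
#true-empty (suc m) P e (suc v) | false = #true-empty m (P ∘ suc) e v

#true-unique : ∀ m P v → P v ≡ true → (∀ u → P u ≡ true → u ≡ v) → #true m P ≡ 1
#true-unique (suc m) P zero    Pv h =
  cong₂ _+_ (cong 𝟙 Pv) (#true-none m λ u → ¬-not λ Pu → contradiction (h (suc u) Pu) λ ())
#true-unique (suc m) P (suc v) Pv h =
  cong₂ _+_ (cong 𝟙 (¬-not {P zero} λ P0 → contradiction (h zero P0) λ ()))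
            (#true-unique m (P ∘ suc) v Pv λ u Pu → Fin.suc-injective (h (suc u) Pu))

#true-1 : ∀ m P → #true m P ≡ 1 → ∀ u v → P u ≡ true → P v ≡ true → u ≡ v
#true-1 (suc m) P e zero    zero    Pu Pv = refl
#true-1 (suc m) P e zero    (suc v) Pu Pv rewrite Pu =
  contradiction (trans (sym Pv) (#true-empty m (P ∘ suc) (suc-injective e) v)) λ ()
#true-1 (suc m) P e (suc u) zero    Pu Pv rewrite Pv =
  contradiction (trans (sym Pu) (#true-empty m (P ∘ suc) (suc-injective e) u)) λ ()
#true-1 (suc m) P e (suc u) (suc v) Pu Pv with P zero
... | true  = contradiction (trans (sym Pv) (#true-empty m (P ∘ suc) (suc-injective e) v)) λ ()
... | false = cong suc (#true-1 m (P ∘ suc) e u v Pu Pv)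

every-elim : ∀ m P → every m P ≡ true → ∀ v → P v ≡ true
every-elim (suc m) P e zero    = ∧-conicalˡ (P zero) _ e
every-elim (suc m) P e (suc v) = every-elim m (P ∘ suc) (∧-conicalʳ (P zero) _ e) v

every-intro : ∀ m {P} → (∀ v → P v ≡ true) → every m P ≡ true
every-intro zero    h = refl
every-intro (suc m) h = cong₂ _∧_ (h zero) (every-intro m (h ∘ suc))

<ᵇ-true : ∀ {a b} → (a <ᵇ b) ≡ true → a < b
<ᵇ-true {a} {b} e = <ᵇ⇒< a b (Equivalence.from T-≡ e)

true-<ᵇ : ∀ {a b} → a < b → (a <ᵇ b) ≡ true
true-<ᵇ p = Equivalence.to T-≡ (<⇒<ᵇ p)

-- The level of a vertex is computed along its path to the root

nextLevel : ℕ → ℕ → ℕ → ℕ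
nextLevel v u l = if (v <ᵇ u) ∧ (l ≡ᵇ 0) then 0 else suc l

-- Merges the three cases of `edge` into two: the edge stays within the maximal decreasing subtree,
-- or the level rises by one.
data EdgeView (lv lu v u : ℕ) : Set where
  inside  : v < u → lu ≡ 0 → lv ≡ 0 → EdgeView lv lu v u
  outside : (lu ≡ 0 → u < v) → lv ≡ suc lu → EdgeView lv lu v u

edge-view : ∀ lv lu v u → edge lv lu v u ≡ true → EdgeView lv lu v u
edge-view 0             lu v u e =
  inside (<ᵇ-true (∧-conicalˡ (v <ᵇ u) _ e)) (≡ᵇ-true lu 0 (∧-conicalʳ (v <ᵇ u) _ e)) refl
edge-view 1             lu v u e =
  outside (λ _ → <ᵇ-true (∧-conicalˡ (u <ᵇ v) _ e))
          (cong suc (sym (≡ᵇ-true lu 0 (∧-conicalʳ (u <ᵇ v) _ e))))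
edge-view (suc (suc i)) lu v u e with refl ← ≡ᵇ-true lu (suc i) e = outside (λ ()) refl

edge⇒nextLevel : ∀ lv lu v u → edge lv lu v u ≡ true → nextLevel v u lu ≡ lv
edge⇒nextLevel lv lu v u e with edge-view lv lu v u e
... | inside v<u refl refl rewrite true-<ᵇ v<u = refl
... | outside u<v refl with lu
...   | suc _ rewrite ∧-zeroʳ (v <ᵇ u) = refl
...   | zero with v <ᵇ u in e′
...     | false = refl
...     | true  = contradiction (u<v refl) (<-asym (<ᵇ-true {v} {u} e′))

-- Level 1 asks for `u < v`, whereas `nextLevel` only knows that `v < u` fails; `v ≢ u` closes the
-- gap.
edge-nextLevel : ∀ l v u → v ≢ u → edge (nextLevel v u l) l v u ≡ true
edge-nextLevel l v u v≢u with (v <ᵇ u) ∧ (l ≡ᵇ 0) in e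
... | true  = e
edge-nextLevel (suc i) v u v≢u | false = true-≡ᵇ {i} refl
edge-nextLevel zero    v u v≢u | false = cong₂ _∧_ (true-<ᵇ (≤∧≢⇒< (≮⇒≥ v≮u) (v≢u ∘ sym))) refl
  where
  v≮u : ¬ v < u
  v≮u v<u = contradiction (trans (sym (cong (_∧ true) (true-<ᵇ v<u))) e) λ ()

nextLevel-≡ᵇ0 : ∀ v u l → (nextLevel v u l ≡ᵇ 0) ≡ (v <ᵇ u) ∧ (l ≡ᵇ 0)
nextLevel-≡ᵇ0 v u l with (v <ᵇ u) ∧ (l ≡ᵇ 0)
... | true  = refl
... | false = refl

nextLevel-≤ : ∀ v u l → nextLevel v u l ≤ suc l
nextLevel-≤ v u l with (v <ᵇ u) ∧ (l ≡ᵇ 0)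
... | true  = z≤n
... | false = ≤-refl

-- The value 1 without fuel is junk, chosen nonzero because inMD is false there.
treeLevel : ∀ {n} → ParentMap n → ℕ → Fin (suc n) → ℕ
treeLevel p fuel v with lookup p v
... | nothing = 0
treeLevel p zero       v | just u = 1
treeLevel p (suc fuel) v | just u = nextLevel (toℕ v) (toℕ u) (treeLevel p fuel u)

treeLevel-≤ : ∀ {n} (p : ParentMap n) f v → treeLevel p f v ≤ suc f
treeLevel-≤ p f       v with lookup p v
treeLevel-≤ p f       v | nothing = z≤n
treeLevel-≤ p zero    v | just u  = ≤-refl
treeLevel-≤ p (suc f) v | just u  = ≤-trans (nextLevel-≤ (toℕ v) (toℕ u) _) (s≤s (treeLevel-≤ p f u))

inMD≡treeLevel-0 : ∀ {n} (p : ParentMap n) f v → inMD p f v ≡ (treeLevel p f v ≡ᵇ 0)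
inMD≡treeLevel-0 p f       v with lookup p v
inMD≡treeLevel-0 p f       v | nothing = refl
inMD≡treeLevel-0 p zero    v | just u  = refl
inMD≡treeLevel-0 p (suc f) v | just u  =
  trans (cong ((toℕ v <ᵇ toℕ u) ∧_) (inMD≡treeLevel-0 p f u))
        (sym (nextLevel-≡ᵇ0 (toℕ v) (toℕ u) (treeLevel p f u)))

-- The level of a vertex is computed from that of its parent with one unit of fuel less. This lets
-- both be taken with the same fuel.
treeLevel-stable : ∀ {n} (p : ParentMap n) f v → reachesRoot p f v ≡ true →
                   treeLevel p (suc f) v ≡ treeLevel p f v
treeLevel-stable p f       v r with lookup p v
treeLevel-stable p f       v r | nothing = refl
treeLevel-stable p (suc f) v r | just u  = cong (nextLevel (toℕ v) (toℕ u)) (treeLevel-stable p f u r)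

reaches-no-loop : ∀ {n} (p : ParentMap n) f v → lookup p v ≡ just v → reachesRoot p f v ≡ false
reaches-no-loop p f       v e with lookup p v in eq
reaches-no-loop p zero    v e    | just u = refl
reaches-no-loop p (suc f) v refl | just u = reaches-no-loop p f v eq

isRootB⇒nothing : ∀ {n} (p : ParentMap n) v → isRootB p v ≡ true → lookup p v ≡ nothing
isRootB⇒nothing p v e with lookup p v
... | nothing = refl

nothing⇒isRootB : ∀ {n} (p : ParentMap n) v → lookup p v ≡ nothing → isRootB p v ≡ true
nothing⇒isRootB p v e rewrite e = refl

reaches⇒root : ∀ {n} (p : ParentMap n) f v → reachesRoot p f v ≡ true → ∃ λ r → lookup p r ≡ nothing
reaches⇒root p f       v r with lookup p v in eq
reaches⇒root p f       v r | nothing = v , eq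
reaches⇒root p (suc f) v r | just u  = reaches⇒root p f u r

-- A parent map along which some rank decreases reaches the root within n + 1
-- steps: a longer path would repeat a vertex.
module _ {n} (p : ParentMap n) (rank : Fin (suc n) → ℕ)
         (decreasing : ∀ v u → lookup p v ≡ just u → rank u < rank v) where

  ancestor : Fin (suc n) → ℕ → Fin (suc n)
  ancestor v zero    = v
  ancestor v (suc i) with lookup p v
  ... | nothing = v
  ... | just u  = ancestor u i

  rank-ancestor-≤ : ∀ v i → rank (ancestor v i) ≤ rank v
  rank-ancestor-≤ v zero    = ≤-refl
  rank-ancestor-≤ v (suc i) with lookup p v in eq
  ... | nothing = ≤-refl
  ... | just u  = ≤-trans (rank-ancestor-≤ u i) (<⇒≤ (decreasing v u eq))

  -- Since the root is not reached within `f` steps, the walk never comes to rest there, and each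
  -- step lowers the rank.
  rank-ancestor-< : ∀ f v i j → reachesRoot p f v ≡ false → i < j → j ≤ f →
                    rank (ancestor v j) < rank (ancestor v i)
  rank-ancestor-< (suc f) v i       (suc j) e i<j j≤f with lookup p v in eq
  rank-ancestor-< (suc f) v zero    (suc j) e i<j j≤f | just u =
    ≤-<-trans (rank-ancestor-≤ u j) (decreasing v u eq)
  rank-ancestor-< (suc f) v (suc i) (suc j) e (s≤s i<j) (s≤s j≤f) | just u
    rewrite eq = rank-ancestor-< f u i j e i<j j≤f

  decreasing⇒reaches : ∀ v → reachesRoot p (suc n) v ≡ true
  decreasing⇒reaches v with reachesRoot p (suc n) v in e
  ... | true  = refl
  -- The positions 0 to n + 1 of the walk are n + 2 in number, among n + 1 vertices.
  ... | false with Fin.pigeonhole (n<1+n (suc n)) (ancestor v ∘ toℕ)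
  ...   | i , j , i<j , same =
    contradiction (cong rank (sym same))
      (<⇒≢ (rank-ancestor-< (suc n) v (toℕ i) (toℕ j) e i<j (s≤s⁻¹ (Fin.toℕ<n j))))

-- Valid labellings come from rooted trees

admissible-cong : ∀ {m} {ℓ ℓ′ : Fin m → ℕ} → (∀ v → ℓ v ≡ ℓ′ v) → ∀ v x →
                  admissible ℓ v x ≡ admissible ℓ′ v x
admissible-cong {m} h v nothing  = cong₂ (λ l c → (l ≡ᵇ 0) ∧ (c ≡ᵇ 0)) (h v)
  (∑-cong (fin m) λ u → cong (λ l → 𝟙 ((toℕ v <ᵇ toℕ u) ∧ (l ≡ᵇ 0))) (h u))
admissible-cong h v (just u) = cong₂ (λ lv lu → edge lv lu (toℕ v) (toℕ u)) (h v) (h u)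

module _ {n} (ℓ : Fin (suc n) → ℕ) (p : ParentMap n) (val : valid ℓ p ≡ true) where

  valid-at : ∀ v {x} → lookup p v ≡ x → admissible ℓ v x ≡ true
  valid-at v refl = every-elim (suc n) (λ u → admissible ℓ u (lookup p u)) val v

  valid-root : ∀ v → lookup p v ≡ nothing → ℓ v ≡ 0
  valid-root v e = ≡ᵇ-true (ℓ v) 0 (∧-conicalˡ (ℓ v ≡ᵇ 0) _ (valid-at v e))

  -- The rank is lexicographic: the level first, then the reversed label, which is less than
  -- `suc n`. Towards the root either the level drops, or it stays 0 and the label grows.
  valid-rank : ∀ v u → lookup p v ≡ just u →
               ℓ u * suc n + (n ∸ toℕ u) < ℓ v * suc n + (n ∸ toℕ v)
  valid-rank v u e with edge-view (ℓ v) (ℓ u) (toℕ v) (toℕ u) (valid-at v e)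
  ... | inside v<u ℓu≡0 ℓv≡0 rewrite ℓu≡0 | ℓv≡0 = ∸-monoʳ-< v<u (s≤s⁻¹ (Fin.toℕ<n u))
  ... | outside _ ℓv≡ rewrite ℓv≡ = ≤-trans
    (≤-trans (≤-reflexive (sym (+-suc (ℓ u * suc n) _)))
             (≤-trans (+-monoʳ-≤ (ℓ u * suc n) (s≤s (m∸n≤m n (toℕ u))))
                      (≤-reflexive (+-comm (ℓ u * suc n) (suc n)))))
    (m≤m+n _ _)

  valid⇒reaches : ∀ v → reachesRoot p (suc n) v ≡ true
  valid⇒reaches = decreasing⇒reaches p (λ v → ℓ v * suc n + (n ∸ toℕ v)) valid-rank

  valid-roots-≮ : ∀ r s → lookup p r ≡ nothing → lookup p s ≡ nothing → ¬ toℕ r < toℕ s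
  valid-roots-≮ r s er es r<s = contradiction
    (trans (sym (cong₂ _∧_ (true-<ᵇ r<s) (true-≡ᵇ (valid-root s es))))
           (#true-empty (suc n) (λ u → (toℕ r <ᵇ toℕ u) ∧ (ℓ u ≡ᵇ 0))
             (≡ᵇ-true (larger ℓ r) 0 (∧-conicalʳ (ℓ r ≡ᵇ 0) _ (valid-at r er))) s))
    λ ()

  valid⇒isRootedTree : isRootedTree p ≡ true
  valid⇒isRootedTree with reaches⇒root p (suc n) zero (valid⇒reaches zero)
  ... | r , er = cong₂ _∧_
    (true-≡ᵇ (trans (countV≡#true (isRootB p))
      (#true-unique (suc n) (isRootB p) r (nothing⇒isRootB p r er) λ s es →
        let es′ = isRootB⇒nothing p s es in
        Fin.toℕ-injective (≤-antisym (≮⇒≥ (valid-roots-≮ r s er es′)) (≮⇒≥ (valid-roots-≮ s r es′ er))))))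
    (true-≡ᵇ (trans (countV≡#true (reachesRoot p (suc n))) (#true-all (suc n) valid⇒reaches)))

  -- The edge conditions determine the level of a vertex from that of its parent, and the root has
  -- level 0. So a parent map has at most one valid labelling.
  valid⇒treeLevel : ∀ f v → reachesRoot p f v ≡ true → treeLevel p f v ≡ ℓ v
  valid⇒treeLevel f       v r with lookup p v in eq
  valid⇒treeLevel f       v r | nothing = sym (valid-root v eq)
  valid⇒treeLevel (suc f) v r | just u  =
    trans (cong (nextLevel (toℕ v) (toℕ u)) (valid⇒treeLevel f u r))
          (edge⇒nextLevel (ℓ v) (ℓ u) (toℕ v) (toℕ u) (valid-at v eq))

-- The levels of a rooted tree are valid

module _ {n} (p : ParentMap n) (tree : isRootedTree p ≡ true) where

  tree-reaches : ∀ v → reachesRoot p (suc n) v ≡ true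
  tree-reaches = #true-full (suc n) _ (trans (sym (countV≡#true (reachesRoot p (suc n))))
    (≡ᵇ-true _ _ (∧-conicalʳ (countV (isRootB p) ≡ᵇ 1) _ tree)))

  tree-root-unique : ∀ r s → lookup p r ≡ nothing → lookup p s ≡ nothing → r ≡ s
  tree-root-unique r s er es = #true-1 (suc n) (isRootB p)
    (trans (sym (countV≡#true (isRootB p))) (≡ᵇ-true _ _ (∧-conicalˡ (countV (isRootB p) ≡ᵇ 1) _ tree)))
    r s (nothing⇒isRootB p r er) (nothing⇒isRootB p s es)

  -- Labels increase towards the root inside the maximal decreasing subtree.
  md-≤-root : ∀ r → lookup p r ≡ nothing → ∀ f v → treeLevel p f v ≡ 0 → toℕ v ≤ toℕ r
  md-≤-root r er f       v e with lookup p v in eq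
  md-≤-root r er f       v e | nothing = ≤-reflexive (cong toℕ (tree-root-unique v r eq er))
  md-≤-root r er (suc f) v e | just u  = ≤-trans
    (<⇒≤ (<ᵇ-true (∧-conicalˡ (toℕ v <ᵇ toℕ u) _ both)))
    (md-≤-root r er f u (≡ᵇ-true _ 0 (∧-conicalʳ (toℕ v <ᵇ toℕ u) _ both)))
    where
    both : (toℕ v <ᵇ toℕ u) ∧ (treeLevel p f u ≡ᵇ 0) ≡ true
    both = trans (sym (nextLevel-≡ᵇ0 (toℕ v) (toℕ u) (treeLevel p f u))) (true-≡ᵇ e)

  tree-nothing : ∀ v → lookup p v ≡ nothing → treeLevel p (suc n) v ≡ 0
  tree-nothing v e rewrite e = refl

  tree-just : ∀ v u → lookup p v ≡ just u →
    treeLevel p (suc n) v ≡ nextLevel (toℕ v) (toℕ u) (treeLevel p (suc n) u)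
  tree-just v u e with tree-reaches v
  ... | r rewrite e = cong (nextLevel (toℕ v) (toℕ u)) (sym (treeLevel-stable p n u r))

  tree-admissible : ∀ v x → lookup p v ≡ x → admissible (treeLevel p (suc n)) v x ≡ true
  tree-admissible v nothing e = cong₂ _∧_ (true-≡ᵇ (tree-nothing v e))
    (true-≡ᵇ (#true-none (suc n) λ u → ¬-not λ both →
      <⇒≱ (<ᵇ-true (∧-conicalˡ (toℕ v <ᵇ toℕ u) _ both))
          (md-≤-root v e (suc n) u (≡ᵇ-true _ 0 (∧-conicalʳ (toℕ v <ᵇ toℕ u) _ both)))))
  tree-admissible v (just u) e = trans
    (cong (λ l → edge l (treeLevel p (suc n) u) (toℕ v) (toℕ u)) (tree-just v u e))
    (edge-nextLevel (treeLevel p (suc n) u) (toℕ v) (toℕ u) λ v≡u → contradiction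
      (trans (sym (tree-reaches v))
             (reaches-no-loop p (suc n) v (trans e (cong just (sym (Fin.toℕ-injective v≡u))))))
      λ ())

-- Levels as elements of a finite type

fromDepth : ∀ h i → i < h → Lev h
fromDepth (suc h) zero    _         = inj₁ tt
fromDepth (suc h) (suc i) (s<s i<h) = inj₂ (fromDepth h i i<h)

depth-fromDepth : ∀ h i (i<h : i < h) → depth h (fromDepth h i i<h) ≡ i
depth-fromDepth (suc h) zero    _         = refl
depth-fromDepth (suc h) (suc i) (s<s i<h) = cong suc (depth-fromDepth h i i<h)

depth-injective : ∀ h b c → depth h b ≡ depth h c → b ≡ c
depth-injective (suc h) (inj₁ _) (inj₁ _) e = refl
depth-injective (suc h) (inj₂ b) (inj₂ c) e = cong inj₂ (depth-injective h b c (suc-injective e))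

fromLevel : ∀ h i → i < suc (suc h) → Level h
fromLevel h 0             _               = inj₁ true
fromLevel h 1             _               = inj₁ false
fromLevel h (suc (suc i)) (s<s (s<s i<h)) = inj₂ (fromDepth h i i<h)

level-fromLevel : ∀ h i i<h → level h (fromLevel h i i<h) ≡ i
level-fromLevel h 0             _               = refl
level-fromLevel h 1             _               = refl
level-fromLevel h (suc (suc i)) (s<s (s<s i<h)) = cong (λ d → suc (suc d)) (depth-fromDepth h i i<h)

level-injective : ∀ h x y → level h x ≡ level h y → x ≡ y
level-injective h (inj₁ true)  (inj₁ true)  e = refl
level-injective h (inj₁ false) (inj₁ false) e = refl
level-injective h (inj₁ true)  (inj₁ false) ()
level-injective h (inj₁ false) (inj₁ true)  ()
level-injective h (inj₁ true)  (inj₂ _) ()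
level-injective h (inj₁ false) (inj₂ _) ()
level-injective h (inj₂ _) (inj₁ true) ()
level-injective h (inj₂ _) (inj₁ false) ()
level-injective h (inj₂ b)     (inj₂ c)     e =
  cong inj₂ (depth-injective h b c (suc-injective (suc-injective e)))

-- With fuel n + 1 a level is at most n + 2, which fits: `Level (suc n)` has the two levels of
-- `Bool` and n + 1 deeper ones.
levelOf : ∀ {n} → ParentMap n → Fin (suc n) → Level (suc n)
levelOf {n} p v = fromLevel (suc n) (treeLevel p (suc n) v) (s≤s (treeLevel-≤ p (suc n) v))

level-levelOf : ∀ {n} (p : ParentMap n) v → level (suc n) (levelOf p v) ≡ treeLevel p (suc n) v
level-levelOf {n} p v =
  level-fromLevel (suc n) (treeLevel p (suc n) v) (s≤s (treeLevel-≤ p (suc n) v))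

levels : ∀ {n} → ParentMap n → Vec (Level (suc n)) (suc n)
levels p = Vec.tabulate (levelOf p)

level-levels : ∀ {n} (p : ParentMap n) v → level (suc n) (lookup (levels p) v) ≡ treeLevel p (suc n) v
level-levels {n} p v =
  trans (cong (level (suc n)) (Vec.lookup∘tabulate (levelOf p) v)) (level-levelOf p v)

levels-unique : ∀ {n} (p : ParentMap n) xs → (∀ v → treeLevel p (suc n) v ≡ level (suc n) (lookup xs v)) →
                levels p ≡ xs
levels-unique {n} p xs h = trans
  (Vec.tabulate-cong λ v → level-injective (suc n) _ _ (trans (level-levelOf p v) (h v)))
  (Vec.tabulate∘lookup xs)

mdSize≡mdCount : ∀ {n} (p : ParentMap n) {ℓ} → (∀ v → treeLevel p (suc n) v ≡ ℓ v) → mdSize p ≡ mdCount ℓ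
mdSize≡mdCount {n} p h = trans (countV≡#true (inMD p (suc n)))
  (∑-cong (fin (suc n)) λ v → cong 𝟙 (trans (inMD≡treeLevel-0 p (suc n) v) (cong (_≡ᵇ 0) (h v))))

-- The bijection between trees and labelled trees

open Decidable⇒UIP Bool._≟_ using () renaming (≡-irrelevant to Bool-irrelevant)

-- The parent map is left unchanged; the labelling is added or forgotten, and nothing is lost
-- because the valid labelling is unique and the remaining components are proofs of equations
-- between booleans or numbers.
T-↔-Labelled : ∀ n k → T[ n , k ] ↔ Labelled (suc n) n k
T-↔-Labelled n k = mk↔ₛ′ to from to-from from-to
  where
  ℓ : Vec (Level (suc n)) (suc n) → Fin (suc n) → ℕ
  ℓ xs = level (suc n) ∘ lookup xs

  to : T[ n , k ] → Labelled (suc n) n k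
  to (p , tree , size) = levels p , p , cong₂ _∧_
    (every-intro (suc n) λ v → trans (admissible-cong (level-levels p) v (lookup p v))
                                     (tree-admissible p tree v _ refl))
    (true-≡ᵇ (trans (sym (mdSize≡mdCount p (sym ∘ level-levels p))) size))

  agree : ∀ xs p → valid (ℓ xs) p ≡ true → ∀ v → treeLevel p (suc n) v ≡ ℓ xs v
  agree xs p val v = valid⇒treeLevel (ℓ xs) p val (suc n) v (valid⇒reaches (ℓ xs) p val v)

  from : Labelled (suc n) n k → T[ n , k ]
  from (xs , p , e) = p , valid⇒isRootedTree (ℓ xs) p val ,
    trans (mdSize≡mdCount p (agree xs p val)) (≡ᵇ-true _ _ (∧-conicalʳ (valid (ℓ xs) p) _ e))
    where val = ∧-conicalˡ (valid (ℓ xs) p) _ e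

  same : ∀ {xs ys p} {d : _ ≡ true} {e : _ ≡ true} → xs ≡ ys →
         _≡_ {A = Labelled (suc n) n k} (xs , p , d) (ys , p , e)
  same {xs} {p = p} refl = cong (λ z → xs , p , z) (Bool-irrelevant _ _)

  to-from : ∀ x → to (from x) ≡ x
  to-from (xs , p , e) =
    same (levels-unique p xs (agree xs p (∧-conicalˡ (valid (ℓ xs) p) _ e)))

  from-to : ∀ t → from (to t) ≡ t
  from-to (p , tree , size) = cong₂ (λ x y → p , x , y) (Bool-irrelevant _ _) (≡-irrelevant _ _)

theorem2p1 : (n k : ℕ) → T[ n , k ] ↔ Fin (rhs n k)
theorem2p1 n k = Labelled-↔-Fin (suc n) n k ≤-refl ↔-∘ T-↔-Labelled n k
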